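{- Let $q\geq 3$ be a prime power and let $(\mathcal{P},\mathcal{G},\mathcal{B})$ be a resolvable transversal design $\mathrm{TD}(q-1,q)$. Let $\mathcal{C}_1(q)$ be the combinatorial batch code whose servers are the $q(q-1)$ points in $\mathcal{P}$ and whose items are the $q^2$ blocks in $\mathcal{B}$, where an item (block) is stored in exactly those servers that are the points it contains. Then $\mathcal{C}_1(q)$ is a $(q-1)$-uniform $(q^2,\; q^3-q^2,\; q^2-q-1,\; q^2-q)$-CBC, and the gap between the upper bound $$n(m,c,k)\leq \left\lfloor\frac{(k-1)\binom{m}{c}}{\binom{k-1}{c}}\right\rfloor$$ and the number of items of $\mathcal{C}_1(q)$ is equal to $q-2$; that is, with $m=q^2-q$, $k=q^2-q-1$, $c=q-1$, $$\left\lfloor\frac{(k-1)\binom{m}{c}}{\binom{k-1}{c}}\right\rfloor-q^2=q-2.$$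
   Context: An $(n,N,k,m)$-CBC (combinatorial batch code) consists of a set $\mathcal{S}$ of $m$ servers and $n$ items $x_1,\dots,x_n$, where item $x_j$ is stored in the servers of a subset $X_j\subseteq\mathcal{S}$, with total storage $\sum_{j=1}^n|X_j|=N$, such that any $k$ items can be retrieved by reading at most one item from each server; that is, for any $k$ distinct indices $i_1,\dots,i_k$ there exist pairwise distinct servers $s_1,\dots,s_k$ with $s_j\in X_{i_j}$ for all $j$. It is $c$-uniform if $|X_j|=c$ for every $j$ (so $N=cn$). $n(m,c,k)$ denotes the maximum $n$ for which a $c$-uniform $(n,cn,k,m)$-CBC exists; the displayed upper bound on it is a known result from earlier literature. A transversal design $\mathrm{TD}(\ell,h)$ is a triple $(\mathcal{P},\mathcal{G},\mathcal{B})$ where $\mathcal{P}$ is a set of $\ell h$ points; $\mathcal{G}$ is a partition of $\mathcal{P}$ into $\ell$ sets (groups), each of size $h$; $\mathcal{B}$ is a collection of $\ell$-subsets of $\mathcal{P}$ (blocks); each block meets each group in exactly one point; and any pair of points from different groups is contained in exactly one block. It is resolvable if $\mathcal{B}$ can be partitioned into $h$ sets (parallel classes), each containing $h$ blocks, such that each point is contained in exactly one block of each parallel class. -}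

module Defs where

open import Algebra.Properties.CommutativeMonoid.Sum using (sum)
open import Data.Fin.Base using (Fin)
open import Data.Fin.Subset using (Subset; _∈_; ∣_∣)
open import Data.Nat.Base
open import Data.Nat.Combinatorics using (_C_; nCk≡n!/k![n-k]!; k![n∸k]!∣n!)
open import Data.Nat.Divisibility using (∣⇒≤)
open import Data.Nat.DivMod using (_/_; m≥n⇒m/n>0)
open import Data.Nat.Primality using (Prime)
open import Data.Nat.Properties
open import Data.Nat.Tactic.RingSolver using (solve-∀)
open import Data.Product.Base using (_×_; Σ-syntax; ∃-syntax)
open import Data.Product using (∃!)
open import Function.Definitions using (Injective)
open import Relation.Binary.PropositionalEquality using (_≡_; _≢_; sym; subst)

IsPrimePower : ℕ → Set
IsPrimePower q = ∃[ p ] ∃[ e ] Prime p × 1 ≤ e × q ≡ p ^ e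

-- The blocks form an indexed family.  For ℓ ≥ 2 and h ≥ 1 it has no
-- repetitions, since a pair of points from different groups lies in only one
-- member of the family.
record TransversalDesign (ℓ h : ℕ) : Set where
  field
    group          : Fin ℓ → Subset (ℓ * h)
    group-covers   : ∀ x → ∃! _≡_ (λ i → x ∈ group i)
    group-size     : ∀ i → ∣ group i ∣ ≡ h
    numBlocks      : ℕ
    block          : Fin numBlocks → Subset (ℓ * h)
    block-size     : ∀ B → ∣ block B ∣ ≡ ℓ
    block-group    : ∀ B i → ∃! _≡_ (λ x → x ∈ block B × x ∈ group i)
    pair-block     : ∀ {i j x y} → i ≢ j → x ∈ group i → y ∈ group j →
                     ∃! _≡_ (λ B → x ∈ block B × y ∈ block B)

record Resolution {ℓ h : ℕ} (D : TransversalDesign ℓ h) : Set where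
  open TransversalDesign D
  field
    class          : Fin h → Subset numBlocks
    class-covers   : ∀ B → ∃! _≡_ (λ c → B ∈ class c)
    class-size     : ∀ c → ∣ class c ∣ ≡ h
    class-parallel : ∀ c x → ∃! _≡_ (λ B → B ∈ class c × x ∈ block B)

record Code : Set where
  field
    numItems   : ℕ
    numServers : ℕ
    stored     : Fin numItems → Subset numServers

  storage : ℕ
  storage = sum +-0-commutativeMonoid (λ j → ∣ stored j ∣)

open Code

Retrievable : ℕ → Code → Set
Retrievable k 𝒞 =
  (i : Fin k → Fin (numItems 𝒞)) → Injective _≡_ _≡_ i →
  Σ[ s ∈ (Fin k → Fin (numServers 𝒞)) ]
    Injective _≡_ _≡_ s × (∀ j → s j ∈ stored 𝒞 (i j))

record IsCBC (n N k m : ℕ) (𝒞 : Code) : Set where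
  field
    items       : numItems 𝒞 ≡ n
    servers     : numServers 𝒞 ≡ m
    storage≡N   : storage 𝒞 ≡ N
    retrievable : Retrievable k 𝒞

Uniform : ℕ → Code → Set
Uniform c 𝒞 = ∀ j → ∣ stored 𝒞 j ∣ ≡ c

𝒞₁ : ∀ {q} → TransversalDesign (q ∸ 1) q → Code
𝒞₁ {q} D = record
  { numItems   = numBlocks
  ; numServers = (q ∸ 1) * q
  ; stored     = block
  }
  where open TransversalDesign D

C-nonZero : ∀ {n k} → k ≤ n → NonZero (n C k)
C-nonZero {n} {k} k≤n =
  >-nonZero (subst (0 <_) (sym (nCk≡n!/k![n-k]! k≤n))
    (m≥n⇒m/n>0 (∣⇒≤ (k![n∸k]!∣n! k≤n))))
  where instance
    _ = k !* (n ∸ k) !≢0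
    _ = n !≢0

-- The known upper bound on the largest n for which a c-uniform
-- (n, c n, k, m)-CBC exists; c ≤ k - 1 makes its denominator nonzero.
upperBound : (m c k : ℕ) → .(c ≤ k ∸ 1) → ℕ
upperBound m c k c≤k-1 =
  (((k ∸ 1) * (m C c)) / ((k ∸ 1) C c)) {{C-nonZero c≤k-1}}

c≤k-1 : ∀ {q} → 3 ≤ q → q ∸ 1 ≤ q ^ 2 ∸ q ∸ 1 ∸ 1
c≤k-1 {suc (suc (suc r))} (s≤s (s≤s (s≤s _))) =
  m+n≤o⇒m≤o∸n (2 + r) (m+n≤o⇒m≤o∸n (2 + r + 1) (m+n≤o⇒m≤o∸n (2 + r + 1 + 1)
    (subst (2 + r + 1 + 1 + (3 + r) ≤_) (expand r) (m≤m+n _ _))))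
  where
  expand : ∀ r → 2 + r + 1 + 1 + (3 + r) + (2 + 4 * r + r * r) ≡ (3 + r) * ((3 + r) * 1)
  expand = solve-∀

{-# OPTIONS --safe #-}

-- By Hall's theorem it suffices that every set T of at most q² − q − 1 blocks
-- covers at least ∣T∣ points.  Let a_g be the number of covered points in group g.
-- A block is determined by its points in two groups, so ∣T∣ ≤ a_g a_h for g ≠ h.
-- If some a_g ≤ q − 2, then (q − 2)∣T∣ ≤ a_g ∑_{h≠g} a_h already gives ∣T∣ ≤ ∑ a_h;
-- if all a_g ≥ q − 1 and two of them equal q − 1, then ∣T∣ ≤ (q − 1)² ≤ ∑ a_h;
-- otherwise ∑ a_h ≥ q(q − 1) − 1 ≥ ∣T∣.
--
-- For the gap, C(m,c) / C(m−2,c) = m(m−1) / ((m−c)(m−c−1)) turns the quotient into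
-- (q² − q − 1)(q + 1) / (q − 1) = q² + q − 1 − 2/(q − 1).
module Submission where

open import Defs
open import Data.Fin.Base using (Fin; zero; suc; punchIn)
open import Data.Fin.Properties using (_≟_; any?; punchInᵢ≢i)
open import Data.Fin.Subset
  using (Subset; _∈_; _∉_; ∣_∣; _∩_; _∪_; _─_; _⊆_; _⊂_; ⊤; ⁅_⁆; Nonempty; inside; outside)
open import Data.Fin.Subset.Properties
open import Data.Nat.Base
open import Data.Nat.Combinatorics using (_C_; nCk≡n!/k![n-k]!; k![n∸k]!∣n!)
open import Data.Nat.DivMod using (_/_; m/n*n≡m; m*n/n≡m; /-monoˡ-≤; m<n*o⇒m/o<n)
open import Data.Nat.Properties hiding (_≟_)
open import Data.Nat.Tactic.RingSolver using (solve-∀)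
open import Data.Product.Base using (_×_; _,_; ∃-syntax; proj₁; proj₂)
open import Data.Sum.Base using (inj₁; inj₂)
open import Data.Product using (∃!)
open import Data.Vec.Base using ([]; _∷_; tabulate; here; there)
open import Data.Vec.Properties using (lookup∘tabulate; lookup⇒[]=; []=⇒lookup)
open import Function.Base using (_∘_)
open import Relation.Binary.PropositionalEquality
open import Relation.Nullary using (¬_; Dec; does; yes; no; contradiction; _×-dec_)
open import Relation.Nullary.Decidable using (dec-true)

open import Algebra.Properties.CommutativeMonoid.Sum +-0-commutativeMonoid
  using (sum; sum-cong-≗; sum-remove; ∑-distrib-+)
open import Algebra.Properties.Semiring.Sum +-*-semiring using (*-distribˡ-sum)

private variable
  k m n : ℕ

-- Finite sums of natural numbers.

sum-const : ∀ n c → sum {n} (λ _ → c) ≡ n * c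
sum-const zero    c = refl
sum-const (suc n) c = cong (c +_) (sum-const n c)

sum-≥ : ∀ {c} (f : Fin n → ℕ) → (∀ i → c ≤ f i) → n * c ≤ sum f
sum-≥ {zero}  f c≤f = z≤n
sum-≥ {suc n} f c≤f = +-mono-≤ (c≤f zero) (sum-≥ (f ∘ suc) (c≤f ∘ suc))

sum-supported-≤ : ∀ {c} (A : Subset m) (f : Fin m → ℕ) →
  (∀ {x} → x ∈ A → f x ≤ c) → (∀ {x} → x ∉ A → f x ≡ 0) → sum f ≤ ∣ A ∣ * c
sum-supported-≤ []            f f≤c f≡0 = z≤n
sum-supported-≤ (inside  ∷ A) f f≤c f≡0 =
  +-mono-≤ (f≤c here) (sum-supported-≤ A (f ∘ suc) (f≤c ∘ there) (λ x∉A → f≡0 (x∉A ∘ drop-there)))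
sum-supported-≤ (outside ∷ A) f f≤c f≡0 =
  subst (λ v → v + sum (f ∘ suc) ≤ _) (sym (f≡0 λ ()))
    (sum-supported-≤ A (f ∘ suc) (f≤c ∘ there) (λ x∉A → f≡0 (x∉A ∘ drop-there)))

-- Subsets of a finite set and their sizes.

⟪_⟫ : {P : Fin n → Set} → (∀ x → Dec (P x)) → Subset n
⟪ P? ⟫ = tabulate (does ∘ P?)

∈⟪⟫⁺ : {P : Fin n → Set} (P? : ∀ x → Dec (P x)) → ∀ {x} → P x → x ∈ ⟪ P? ⟫
∈⟪⟫⁺ P? {x} px = lookup⇒[]= x _ (trans (lookup∘tabulate (does ∘ P?) x) (dec-true (P? x) px))

∈⟪⟫⁻ : {P : Fin n → Set} (P? : ∀ x → Dec (P x)) → ∀ {x} → x ∈ ⟪ P? ⟫ → P x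
∈⟪⟫⁻ P? {x} x∈ with P? x | trans (sym (lookup∘tabulate (does ∘ P?) x)) ([]=⇒lookup x∈)
... | yes px | _  = px
... | no  _  | ()

Empty⇒∣p∣≡0 : {p : Subset n} → ¬ Nonempty p → ∣ p ∣ ≡ 0
Empty⇒∣p∣≡0 {n} ∄ = trans (cong ∣_∣ (Empty-unique ∄)) (∣⊥∣≡0 n)

unique⇒∣p∣≤1 : {p : Subset n} → (∀ {x y} → x ∈ p → y ∈ p → x ≡ y) → ∣ p ∣ ≤ 1
unique⇒∣p∣≤1 {p = p} unique with nonempty? p
... | no  ∄         = ≤-trans (≤-reflexive (Empty⇒∣p∣≡0 ∄)) z≤n
... | yes (x , x∈p) =
  ≤-trans (p⊆q⇒∣p∣≤∣q∣ λ y∈p → subst (_∈ ⁅ x ⁆) (unique x∈p y∈p) (x∈⁅x⁆ x)) (≤-reflexive (∣⁅x⁆∣≡1 x))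

∣p∣>0⇒Nonempty : {p : Subset n} → 0 < ∣ p ∣ → Nonempty p
∣p∣>0⇒Nonempty {p = p} 0<∣p∣ with nonempty? p
... | yes ne = ne
... | no  ∄  = contradiction (subst (0 <_) (Empty⇒∣p∣≡0 ∄) 0<∣p∣) λ ()

∣p∪q∣≤∣p∣+∣q∣ : (p q : Subset n) → ∣ p ∪ q ∣ ≤ ∣ p ∣ + ∣ q ∣
∣p∪q∣≤∣p∣+∣q∣ []            []            = z≤n
∣p∪q∣≤∣p∣+∣q∣ (outside ∷ p) (outside ∷ q) = ∣p∪q∣≤∣p∣+∣q∣ p q
∣p∪q∣≤∣p∣+∣q∣ (outside ∷ p) (inside  ∷ q) =
  ≤-trans (s≤s (∣p∪q∣≤∣p∣+∣q∣ p q)) (≤-reflexive (sym (+-suc ∣ p ∣ ∣ q ∣)))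
∣p∪q∣≤∣p∣+∣q∣ (inside  ∷ p) (outside ∷ q) = s≤s (∣p∪q∣≤∣p∣+∣q∣ p q)
∣p∪q∣≤∣p∣+∣q∣ (inside  ∷ p) (inside  ∷ q) =
  s≤s (≤-trans (∣p∪q∣≤∣p∣+∣q∣ p q) (+-monoʳ-≤ ∣ p ∣ (n≤1+n ∣ q ∣)))

∣p∪q∣-disjoint : (p q : Subset n) → (∀ {x} → x ∈ p → x ∉ q) → ∣ p ∪ q ∣ ≡ ∣ p ∣ + ∣ q ∣
∣p∪q∣-disjoint []            []            dis = refl
∣p∪q∣-disjoint (outside ∷ p) (outside ∷ q) dis =
  ∣p∪q∣-disjoint p q λ x∈p x∈q → dis (there x∈p) (there x∈q)
∣p∪q∣-disjoint (outside ∷ p) (inside  ∷ q) dis =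
  trans (cong suc (∣p∪q∣-disjoint p q λ x∈p x∈q → dis (there x∈p) (there x∈q))) (sym (+-suc ∣ p ∣ ∣ q ∣))
∣p∪q∣-disjoint (inside  ∷ p) (outside ∷ q) dis =
  cong suc (∣p∪q∣-disjoint p q λ x∈p x∈q → dis (there x∈p) (there x∈q))
∣p∪q∣-disjoint (inside  ∷ p) (inside  ∷ q) dis = contradiction here (dis here)

x∈p─q⇒x∉q : (p q : Subset n) → ∀ {x} → x ∈ p ─ q → x ∉ q
x∈p─q⇒x∉q (s ∷ p) (t ∷ q) (there x∈p─q) (there x∈q) = x∈p─q⇒x∉q p q x∈p─q x∈q

-- Counting by fibres.

fibre : (Fin n → Fin m) → Fin m → Subset n
fibre f x = ⟪ (λ t → f t ≟ x) ⟫

-- Written as the size of a one-element subset, so that adding it to the size of a subset gives the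
-- size after prepending that one entry.
indicator : Fin m → Fin m → ℕ
indicator y x = ∣ does (y ≟ x) ∷ [] ∣

sum-indicator : (y : Fin m) → sum (indicator y) ≡ 1
sum-indicator {suc m} zero    = cong suc (trans (sum-const m 0) (*-zeroʳ m))
sum-indicator {suc m} (suc y) = sum-indicator y

-- Induction on `p`: a new element adds one to a single summand, the one at its image `f zero`.
∣p∣≡∑∣p∩fibre∣ : (p : Subset n) (f : Fin n → Fin m) → ∣ p ∣ ≡ sum (λ x → ∣ p ∩ fibre f x ∣)
∣p∣≡∑∣p∩fibre∣ {m = m} []   f = sym (trans (sum-const m 0) (*-zeroʳ m))
∣p∣≡∑∣p∩fibre∣ (outside ∷ p) f = ∣p∣≡∑∣p∩fibre∣ p (f ∘ suc)
∣p∣≡∑∣p∩fibre∣ (inside  ∷ p) f = begin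
  suc ∣ p ∣
    ≡⟨ cong₂ _+_ (sym (sum-indicator (f zero))) (∣p∣≡∑∣p∩fibre∣ p (f ∘ suc)) ⟩
  sum (indicator (f zero)) + sum (λ x → ∣ p ∩ fibre (f ∘ suc) x ∣)
    ≡⟨ ∑-distrib-+ (indicator (f zero)) (λ x → ∣ p ∩ fibre (f ∘ suc) x ∣) ⟨
  sum (λ x → indicator (f zero) x + ∣ p ∩ fibre (f ∘ suc) x ∣)
    ≡⟨ sum-cong-≗ (λ x → ∣∷∣ (does (f zero ≟ x)) (p ∩ fibre (f ∘ suc) x)) ⟩
  sum (λ x → ∣ (inside ∷ p) ∩ fibre f x ∣) ∎
  where
  open ≡-Reasoning
  ∣∷∣ : ∀ b (q : Subset k) → ∣ b ∷ [] ∣ + ∣ q ∣ ≡ ∣ b ∷ q ∣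
  ∣∷∣ inside  q = refl
  ∣∷∣ outside q = refl

-- The parts are the fibres of the map sending each element to the unique index of its part.
∣p∣≡∑∣p∩part∣ : (part : Fin m → Subset n) → (∀ x → ∃! _≡_ (λ i → x ∈ part i)) →
  ∀ p → ∣ p ∣ ≡ sum (λ i → ∣ p ∩ part i ∣)
∣p∣≡∑∣p∩part∣ part cover p = trans (∣p∣≡∑∣p∩fibre∣ p index)
  (sum-cong-≗ λ i → cong (λ q → ∣ p ∩ q ∣) (⊆-antisym (fibre⊆part i) (part⊆fibre i)))
  where
  index : Fin _ → Fin _
  index x = proj₁ (cover x)
  fibre⊆part : ∀ i → fibre index i ⊆ part i
  fibre⊆part i {x} x∈ = subst (λ j → x ∈ part j) (∈⟪⟫⁻ (λ t → index t ≟ i) x∈) (proj₁ (proj₂ (cover x)))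
  part⊆fibre : ∀ i → part i ⊆ fibre index i
  part⊆fibre i {x} x∈ = ∈⟪⟫⁺ (λ t → index t ≟ i) (proj₂ (proj₂ (cover x)) x∈)

-- Fibres over points outside `q` miss `p`, so only `∣ q ∣` terms of the fibre sum can be nonzero.
∣p∣≤∣q∣*c : ∀ {c} (p : Subset n) (q : Subset m) (f : Fin n → Fin m) →
  (∀ {t} → t ∈ p → f t ∈ q) → (∀ {x} → x ∈ q → ∣ p ∩ fibre f x ∣ ≤ c) → ∣ p ∣ ≤ ∣ q ∣ * c
∣p∣≤∣q∣*c p q f maps small = ≤-trans (≤-reflexive (∣p∣≡∑∣p∩fibre∣ p f))
  (sum-supported-≤ q _ small λ {x} x∉q → Empty⇒∣p∣≡0 λ (t , t∈) →
    let t∈p , t∈f = x∈p∩q⁻ p (fibre f x) t∈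
    in x∉q (subst (_∈ q) (∈⟪⟫⁻ (λ t → f t ≟ x) t∈f) (maps t∈p)))

-- The pair of `f` and `g` embeds `p` into the product of `q` and `r`. Counting goes in two stages:
-- by the value of `f`, then within each fibre by the value of `g`.
∣p∣≤∣q∣*∣r∣ : (p : Subset n) (q : Subset k) (r : Subset m) (f : Fin n → Fin k) (g : Fin n → Fin m) →
  (∀ {t} → t ∈ p → f t ∈ q) → (∀ {t} → t ∈ p → g t ∈ r) →
  (∀ {t u} → t ∈ p → u ∈ p → f t ≡ f u → g t ≡ g u → t ≡ u) → ∣ p ∣ ≤ ∣ q ∣ * ∣ r ∣
∣p∣≤∣q∣*∣r∣ {k = k} p q r f g f∈q g∈r inj = ∣p∣≤∣q∣*c p q f f∈q λ {x} _ →
  let open Fibre x in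
  ≤-trans (∣p∣≤∣q∣*c (p ∩ fibre f x) r g (g∈r ∘ in-p) λ {y} _ → unique⇒∣p∣≤1 λ t∈ u∈ →
    let t∈₁ , t∈₂ = x∈p∩q⁻ (p ∩ fibre f x) (fibre g y) t∈
        u∈₁ , u∈₂ = x∈p∩q⁻ (p ∩ fibre f x) (fibre g y) u∈
    in inj (in-p t∈₁) (in-p u∈₁)
         (trans (f≡x t∈₁) (sym (f≡x u∈₁)))
         (trans (∈⟪⟫⁻ (λ t → g t ≟ y) t∈₂) (sym (∈⟪⟫⁻ (λ t → g t ≟ y) u∈₂))))
    (≤-reflexive (*-identityʳ _))
  where
  module Fibre (x : Fin k) where
    in-p : ∀ {t} → t ∈ p ∩ fibre f x → t ∈ p
    in-p = proj₁ ∘ x∈p∩q⁻ p (fibre f x)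
    f≡x : ∀ {t} → t ∈ p ∩ fibre f x → f t ≡ x
    f≡x = ∈⟪⟫⁻ (λ t → f t ≟ x) ∘ proj₂ ∘ x∈p∩q⁻ p (fibre f x)

-- Hall's marriage theorem

neighbour? : (R : Fin n → Subset m) (T : Subset n) (y : Fin m) → Dec (∃[ t ] t ∈ T × y ∈ R t)
neighbour? R T y = any? λ t → (t ∈? T) ×-dec (y ∈? R t)

neighbours : (Fin n → Subset m) → Subset n → Subset m
neighbours R T = ⟪ neighbour? R T ⟫

∈-neighbours⁺ : (R : Fin n → Subset m) {T : Subset n} → ∀ {t y} → t ∈ T → y ∈ R t → y ∈ neighbours R T
∈-neighbours⁺ R t∈T y∈Rt = ∈⟪⟫⁺ (neighbour? R _) (_ , t∈T , y∈Rt)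

∈-neighbours⁻ : (R : Fin n → Subset m) {T : Subset n} → ∀ {y} → y ∈ neighbours R T → ∃[ t ] t ∈ T × y ∈ R t
∈-neighbours⁻ R = ∈⟪⟫⁻ (neighbour? R _)

HallCondition : (Fin n → Subset m) → Subset n → Set
HallCondition R S = ∀ T → T ⊆ S → ∣ T ∣ ≤ ∣ neighbours R T ∣

record Matching (R : Fin n → Subset m) (S : Subset n) : Set where
  field
    match           : ∀ {t} → t ∈ S → Fin m
    match-∈         : ∀ {t} (t∈S : t ∈ S) → match t∈S ∈ R t
    match-injective : ∀ {t u} (t∈S : t ∈ S) (u∈S : u ∈ S) → match t∈S ≡ match u∈S → t ≡ u

-- The first matching takes all its values in `B` and the second avoids `B`, so the two never
-- collide.
combine : {R : Fin n → Subset m} {S T : Subset n} {B : Subset m} (M : Matching R T) →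
  (∀ {t} (t∈T : t ∈ T) → Matching.match M t∈T ∈ B) →
  Matching (λ t → R t ─ B) (S ─ T) → Matching R S
combine {R = R} {S} {T} {B} M M⊆B M′ = record
  { match           = λ {t} t∈S → match (t ∈? T) t∈S
  ; match-∈         = λ {t} t∈S → match-∈ (t ∈? T) t∈S
  ; match-injective = λ {t} {u} t∈S u∈S → match-injective (t ∈? T) (u ∈? T) t∈S u∈S
  }
  where
  module M  = Matching M
  module M′ = Matching M′
  -- The decision is an explicit argument, so that the proofs below can split on it directly.
  match : ∀ {t} → Dec (t ∈ T) → t ∈ S → Fin _
  match (yes t∈T) t∈S = M.match t∈T
  match (no  t∉T) t∈S = M′.match (x∈p∧x∉q⇒x∈p─q t∈S t∉T)
  match-∈ : ∀ {t} (t∈?T : Dec (t ∈ T)) (t∈S : t ∈ S) → match t∈?T t∈S ∈ R t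
  match-∈ {t} (yes t∈T) t∈S = M.match-∈ t∈T
  match-∈ {t} (no  t∉T) t∈S = p─q⊆p (R t) B (M′.match-∈ _)
  M′∉B : ∀ {t} (t∈ : t ∈ S ─ T) → M′.match t∈ ∉ B
  M′∉B {t} t∈ = x∈p─q⇒x∉q (R t) B (M′.match-∈ t∈)
  match-injective : ∀ {t u} (t∈?T : Dec (t ∈ T)) (u∈?T : Dec (u ∈ T)) (t∈S : t ∈ S) (u∈S : u ∈ S) →
    match t∈?T t∈S ≡ match u∈?T u∈S → t ≡ u
  match-injective (yes t∈T) (yes u∈T) _ _ eq = M.match-injective _ _ eq
  match-injective (yes t∈T) (no  u∉T) _ _ eq = contradiction (subst (_∈ B) eq (M⊆B t∈T)) (M′∉B _)
  match-injective (no  t∉T) (yes u∈T) _ _ eq = contradiction (subst (_∈ B) (sym eq) (M⊆B u∈T)) (M′∉B _)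
  match-injective (no  t∉T) (no  u∉T) _ _ eq = M′.match-injective _ _ eq

neighbours-⊆ : (R : Fin n → Subset m) (B : Subset m) {T : Subset n} →
  neighbours R T ⊆ B ∪ neighbours (λ t → R t ─ B) T
neighbours-⊆ R B {T} {y} y∈ with y ∈? B
... | yes y∈B = x∈p∪q⁺ (inj₁ y∈B)
... | no  y∉B =
  let t , t∈T , y∈Rt = ∈-neighbours⁻ R y∈
  in x∈p∪q⁺ (inj₂ (∈-neighbours⁺ (λ t → R t ─ B) t∈T (x∈p∧x∉q⇒x∈p─q y∈Rt y∉B)))

∣neighbours∣≤ : (R : Fin n → Subset m) (B : Subset m) (T : Subset n) →
  ∣ neighbours R T ∣ ≤ ∣ B ∣ + ∣ neighbours (λ t → R t ─ B) T ∣
∣neighbours∣≤ R B T = ≤-trans (p⊆q⇒∣p∣≤∣q∣ (neighbours-⊆ R B)) (∣p∪q∣≤∣p∣+∣q∣ B _)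

-- For `U` disjoint from `T`, Hall's condition on `T ∪ U` counts at most `∣ T ∣` neighbours coming
-- from `T`; cancelling `∣ T ∣` leaves enough new neighbours for `U`.
hallCondition-tight : (R : Fin n → Subset m) {S T : Subset n} → T ⊆ S → ∣ neighbours R T ∣ ≤ ∣ T ∣ →
  HallCondition R S → HallCondition (λ t → R t ─ neighbours R T) (S ─ T)
hallCondition-tight R {S} {T} T⊆S tight hall U U⊆S─T = +-cancelˡ-≤ ∣ T ∣ _ _ (begin
  ∣ T ∣ + ∣ U ∣                      ≡⟨ ∣p∪q∣-disjoint T U (λ t∈T t∈U → x∈p─q⇒x∉q S T (U⊆S─T t∈U) t∈T) ⟨
  ∣ T ∪ U ∣                          ≤⟨ hall (T ∪ U) T∪U⊆S ⟩
  ∣ neighbours R (T ∪ U) ∣           ≤⟨ p⊆q⇒∣p∣≤∣q∣ N[T∪U]⊆ ⟩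
  ∣ NT ∪ neighbours R′ U ∣           ≤⟨ ∣p∪q∣≤∣p∣+∣q∣ NT _ ⟩
  ∣ NT ∣ + ∣ neighbours R′ U ∣       ≤⟨ +-monoˡ-≤ _ tight ⟩
  ∣ T ∣ + ∣ neighbours R′ U ∣        ∎)
  where
  open ≤-Reasoning
  NT = neighbours R T
  R′ = λ t → R t ─ NT
  T∪U⊆S : T ∪ U ⊆ S
  T∪U⊆S t∈ with x∈p∪q⁻ T U t∈
  ... | inj₁ t∈T = T⊆S t∈T
  ... | inj₂ t∈U = p─q⊆p S T (U⊆S─T t∈U)
  N[T∪U]⊆ : neighbours R (T ∪ U) ⊆ NT ∪ neighbours R′ U
  N[T∪U]⊆ y∈ with ∈-neighbours⁻ R y∈
  ... | t , t∈T∪U , y∈Rt with x∈p∪q⁻ T U t∈T∪U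
  ...   | inj₁ t∈T = x∈p∪q⁺ (inj₁ (∈-neighbours⁺ R t∈T y∈Rt))
  ...   | inj₂ t∈U = neighbours-⊆ R NT (∈-neighbours⁺ R t∈U y∈Rt)

-- The Halmos–Vaughan argument, by induction on a bound for ∣ S ∣.
hall : ∀ b (R : Fin n → Subset m) (S : Subset n) → ∣ S ∣ < b → HallCondition R S → Matching R S
hall (suc b) R S (s≤s ∣S∣≤b) cond with nonempty? S
... | no ∄ = record
  { match           = λ t∈S → contradiction (_ , t∈S) ∄
  ; match-∈         = λ t∈S → contradiction (_ , t∈S) ∄
  ; match-injective = λ t∈S _ _ → contradiction (_ , t∈S) ∄
  }
... | yes (i , i∈S) with anySubset? (λ T → (T ⊂? S) ×-dec nonempty? T ×-dec (∣ neighbours R T ∣ ≤? ∣ T ∣))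
-- A tight nonempty proper subset: both `T` and `S ─ T` are smaller than `S`, so each is matched by
-- induction, the latter away from the neighbours of `T`.
...   | yes (T , T⊂S , (t , t∈T) , tight) =
  combine M (λ t∈T → ∈-neighbours⁺ R t∈T (Matching.match-∈ M t∈T))
    (hall b (λ t → R t ─ neighbours R T) (S ─ T)
      (<-≤-trans (p∩q≢∅⇒∣p─q∣<∣p∣ S T (t , x∈p∩q⁺ (T⊆S t∈T , t∈T))) ∣S∣≤b)
      (hallCondition-tight R T⊆S tight cond))
  where
  T⊆S : T ⊆ S
  T⊆S = proj₁ T⊂S
  M : Matching R T
  M = hall b R T (<-≤-trans (p⊂q⇒∣p∣<∣q∣ T⊂S) ∣S∣≤b) (λ U U⊆T → cond U (⊆-trans U⊆T T⊆S))
-- Every nonempty proper subset has a neighbour to spare, so `i` may take any neighbour `y`.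
...   | no ∄tight = combine M (λ _ → x∈⁅x⁆ y)
    (hall b (λ t → R t ─ ⁅ y ⁆) (S ─ ⁅ i ⁆) (<-≤-trans (x∈p⇒∣p-x∣<∣p∣ i∈S) ∣S∣≤b) cond′)
  where
  ⁅i⁆⊆S : ⁅ i ⁆ ⊆ S
  ⁅i⁆⊆S t∈ = subst (_∈ S) (sym (x∈⁅y⁆⇒x≡y i t∈)) i∈S
  N⁅i⁆ : Nonempty (neighbours R ⁅ i ⁆)
  N⁅i⁆ = ∣p∣>0⇒Nonempty (≤-trans (≤-reflexive (sym (∣⁅x⁆∣≡1 i))) (cond ⁅ i ⁆ ⁅i⁆⊆S))
  y = proj₁ N⁅i⁆
  y∈Ri : y ∈ R i
  y∈Ri with ∈-neighbours⁻ R (proj₂ N⁅i⁆)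
  ... | t , t∈⁅i⁆ , y∈Rt = subst (λ t → y ∈ R t) (x∈⁅y⁆⇒x≡y i t∈⁅i⁆) y∈Rt
  M : Matching R ⁅ i ⁆
  M = record
    { match           = λ _ → y
    ; match-∈         = λ t∈ → subst (λ t → y ∈ R t) (sym (x∈⁅y⁆⇒x≡y i t∈)) y∈Ri
    ; match-injective = λ t∈ u∈ _ → trans (x∈⁅y⁆⇒x≡y i t∈) (sym (x∈⁅y⁆⇒x≡y i u∈))
    }
  cond′ : HallCondition (λ t → R t ─ ⁅ y ⁆) (S ─ ⁅ i ⁆)
  cond′ U U⊆ with nonempty? U
  ... | no  ∄  = ≤-trans (≤-reflexive (Empty⇒∣p∣≡0 ∄)) z≤n
  -- `U` omits `i`, hence is proper and not tight; the spare neighbour pays for the deletion of `y`.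
  ... | yes ne = ≤-pred (begin
    suc ∣ U ∣                                          ≤⟨ ≰⇒> (λ N≤U → ∄tight (U , U⊂S , ne , N≤U)) ⟩
    ∣ neighbours R U ∣                                 ≤⟨ ∣neighbours∣≤ R ⁅ y ⁆ U ⟩
    ∣ ⁅ y ⁆ ∣ + ∣ neighbours (λ t → R t ─ ⁅ y ⁆) U ∣   ≡⟨ cong (_+ ∣ neighbours (λ t → R t ─ ⁅ y ⁆) U ∣) (∣⁅x⁆∣≡1 y) ⟩
    suc ∣ neighbours (λ t → R t ─ ⁅ y ⁆) U ∣           ∎)
    where
    open ≤-Reasoning
    U⊂S : U ⊂ S
    U⊂S = (λ t∈U → p─q⊆p S ⁅ i ⁆ (U⊆ t∈U)) ,
          i , i∈S , λ i∈U → x∈p─q⇒x∉q S ⁅ i ⁆ (U⊆ i∈U) (x∈⁅x⁆ i)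

systemOfDistinctRepresentatives : (R : Fin n → Subset m) → (∀ T → ∣ T ∣ ≤ ∣ neighbours R T ∣) →
  ∃[ s ] (∀ {t u} → s t ≡ s u → t ≡ u) × (∀ t → s t ∈ R t)
systemOfDistinctRepresentatives R cond =
  (λ t → match (∈⊤ {x = t})) , match-injective ∈⊤ ∈⊤ , λ t → match-∈ (∈⊤ {x = t})
  where open Matching (hall _ R ⊤ ≤-refl (λ T _ → cond T))

-- Hall's condition for the blocks of the design.

-- From here on 3 + r plays the role of q.
-- Summing t ≤ a i * a j over j ≢ i settles every case with some a i ≤ 1 + r.
pairwise-product-bound : ∀ r (a : Fin (2 + r) → ℕ) {t} →
  (∀ {i j} → i ≢ j → t ≤ a i * a j) → t < (2 + r) * (3 + r) → t ≤ sum a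
pairwise-product-bound r a {t} t≤aa t< with any? (λ i → a i ≤? 1 + r)
... | yes (i , ai≤) = begin
  t          ≤⟨ *-cancelˡ-≤ (1 + r) [1+r]t≤ ⟩
  rest       ≤⟨ m≤n+m rest (a i) ⟩
  a i + rest ≡⟨ sum-remove {i = i} a ⟨
  sum a      ∎
  where
  open ≤-Reasoning
  rest = sum (a ∘ punchIn i)
  -- There are exactly `1 + r` indices besides `i`, which matches the bound on `a i`, so this factor
  -- cancels.
  [1+r]t≤ : (1 + r) * t ≤ (1 + r) * rest
  [1+r]t≤ = begin
    (1 + r) * t                          ≤⟨ sum-≥ _ (λ j → t≤aa (punchInᵢ≢i i j ∘ sym)) ⟩
    sum (λ j → a i * a (punchIn i j))    ≡⟨ *-distribˡ-sum (a i) (a ∘ punchIn i) ⟨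
    a i * rest                           ≤⟨ *-monoˡ-≤ rest ai≤ ⟩
    (1 + r) * rest                       ∎
... | no ∄≤1+r with any? (λ i → a i ≤? 2 + r)
-- All entries are at least `3 + r`, so the sum is at least `(2 + r) * (3 + r)`.
...   | no ∄≤2+r = ≤-trans (<⇒≤ t<) (sum-≥ a λ i → ≰⇒> λ ai≤ → ∄≤2+r (i , ai≤))
...   | yes (i , ai≤) with any? (λ j → a (punchIn i j) ≤? 2 + r)
-- Two entries are at most `2 + r`, so `t` is at most its square; each of the `2 + r` entries is at
-- least `2 + r`.
...     | yes (j , aj≤) = ≤-trans (t≤aa (punchInᵢ≢i i j ∘ sym))
  (≤-trans (*-mono-≤ ai≤ aj≤) (sum-≥ a λ i → ≰⇒> λ ai≤ → ∄≤1+r (i , ai≤)))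
-- Only `a i` falls below `3 + r`, and by just one; the strict inequality `t<` absorbs this deficit
-- exactly.
...     | no ∄j = begin
  t                             ≤⟨ ≤-pred (≤-trans t< (≤-reflexive (expand r))) ⟩
  (2 + r) + (1 + r) * (3 + r)   ≤⟨ +-mono-≤ (≰⇒> λ ai≤ → ∄≤1+r (i , ai≤))
                                     (sum-≥ (a ∘ punchIn i) λ j → ≰⇒> λ aj≤ → ∄j (j , aj≤)) ⟩
  a i + sum (a ∘ punchIn i)     ≡⟨ sum-remove {i = i} a ⟨
  sum a                         ∎
  where
  open ≤-Reasoning
  expand : ∀ r → (2 + r) * (3 + r) ≡ suc ((2 + r) + (1 + r) * (3 + r))
  expand = solve-∀

module _ {r : ℕ} (D : TransversalDesign (2 + r) (3 + r)) where
  open TransversalDesign D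

  -- The parallel classes partition the blocks into `3 + r` sets of size `3 + r`.
  numBlocks≡ : Resolution D → numBlocks ≡ (3 + r) * (3 + r)
  numBlocks≡ res = begin
    numBlocks                        ≡⟨ ∣⊤∣≡n numBlocks ⟨
    ∣ ⊤ {numBlocks} ∣                ≡⟨ ∣p∣≡∑∣p∩part∣ class class-covers ⊤ ⟩
    sum (λ c → ∣ ⊤ ∩ class c ∣)      ≡⟨ sum-cong-≗ (λ c → trans (cong ∣_∣ (∩-identityˡ (class c))) (class-size c)) ⟩
    sum {3 + r} (λ _ → 3 + r)        ≡⟨ sum-const (3 + r) (3 + r) ⟩
    (3 + r) * (3 + r)                ∎
    where
    open ≡-Reasoning
    open Resolution res

  ∣blocks∣≤∣points∣ : ∀ {k} (b : Fin k → Fin numBlocks) → (∀ {t u} → b t ≡ b u → t ≡ u) →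
    k < (2 + r) * (3 + r) → ∀ T → ∣ T ∣ ≤ ∣ neighbours (block ∘ b) T ∣
  ∣blocks∣≤∣points∣ {k} b b-injective k< T = begin
    ∣ T ∣                         ≤⟨ pairwise-product-bound r (λ g → ∣ N ∩ group g ∣) ∣T∣≤ (≤-<-trans (∣p∣≤n T) k<) ⟩
    sum (λ g → ∣ N ∩ group g ∣)   ≡⟨ ∣p∣≡∑∣p∩part∣ group group-covers N ⟨
    ∣ N ∣                         ∎
    where
    open ≤-Reasoning
    N = neighbours (block ∘ b) T
    point : Fin (2 + r) → Fin k → Fin ((2 + r) * (3 + r))
    point g t = proj₁ (block-group (b t) g)
    point∈block : ∀ g t → point g t ∈ block (b t)
    point∈block g t = proj₁ (proj₁ (proj₂ (block-group (b t) g)))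
    point∈group : ∀ g t → point g t ∈ group g
    point∈group g t = proj₂ (proj₁ (proj₂ (block-group (b t) g)))
    ∣T∣≤ : ∀ {g h} → g ≢ h → ∣ T ∣ ≤ ∣ N ∩ group g ∣ * ∣ N ∩ group h ∣
    ∣T∣≤ {g} {h} g≢h = ∣p∣≤∣q∣*∣r∣ T (N ∩ group g) (N ∩ group h) (point g) (point h)
      (point∈N∩group g) (point∈N∩group h)
      -- Equal points in the groups `g` and `h` put `b t` and `b u` through the same pair of points,
      -- so `pair-block` identifies the two blocks.
      λ {t} {u} _ _ eq-g eq-h →
        let _ , _ , unique = pair-block g≢h (point∈group g u) (point∈group h u)
        in b-injective (trans
          (sym (unique (subst (_∈ block (b t)) eq-g (point∈block g t) , subst (_∈ block (b t)) eq-h (point∈block h t))))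
          (unique (point∈block g u , point∈block h u)))
      where
      point∈N∩group : ∀ g {t} → t ∈ T → point g t ∈ N ∩ group g
      point∈N∩group g {t} t∈T = x∈p∩q⁺ (∈-neighbours⁺ (block ∘ b) t∈T (point∈block g t) , point∈group g t)

-- Binomial coefficients and the value of the upper bound.

-- The upper index is written `c + d` to avoid truncated subtraction.
nCk*k![n-k]! : ∀ c d → ((c + d) C c) * (c ! * d !) ≡ (c + d) !
nCk*k![n-k]! c d = begin
  ((c + d) C c) * (c ! * d !)              ≡⟨ cong (λ e → ((c + d) C c) * (c ! * e !)) (m+n∸m≡n c d) ⟨
  ((c + d) C c) * (c ! * (c + d ∸ c) !)    ≡⟨ cong (_* (c ! * (c + d ∸ c) !)) (nCk≡n!/k![n-k]! (m≤m+n c d)) ⟩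
  ((c + d) ! / (c ! * (c + d ∸ c) !)) * (c ! * (c + d ∸ c) !)
                                           ≡⟨ m/n*n≡m (k![n∸k]!∣n! (m≤m+n c d)) ⟩
  (c + d) !                                ∎
  where
  open ≡-Reasoning
  instance _ = c !* (c + d ∸ c) !≢0

-- Multiplied by `c ! * d !`, both sides become `(suc (c + d)) !`.
C-suc : ∀ c d → (suc (c + d) C c) * suc d ≡ suc (c + d) * ((c + d) C c)
C-suc c d = *-cancelʳ-≡ _ _ (c ! * d !) (begin
  (suc (c + d) C c) * suc d * (c ! * d !)     ≡⟨ rearrange (suc (c + d) C c) (suc d) (c !) (d !) ⟩
  (suc (c + d) C c) * (c ! * (suc d) !)       ≡⟨ cong (λ n → (n C c) * (c ! * (suc d) !)) (+-suc c d) ⟨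
  ((c + suc d) C c) * (c ! * (suc d) !)       ≡⟨ nCk*k![n-k]! c (suc d) ⟩
  (c + suc d) !                               ≡⟨ cong _! (+-suc c d) ⟩
  suc (c + d) * (c + d) !                     ≡⟨ cong (suc (c + d) *_) (nCk*k![n-k]! c d) ⟨
  suc (c + d) * (((c + d) C c) * (c ! * d !)) ≡⟨ *-assoc (suc (c + d)) ((c + d) C c) (c ! * d !) ⟨
  suc (c + d) * ((c + d) C c) * (c ! * d !)   ∎)
  where
  open ≡-Reasoning
  instance _ = c !* d !≢0
  rearrange : ∀ w x y z → w * x * (y * z) ≡ w * (y * (x * z))
  rearrange = solve-∀

/-unique : ∀ {x v} d .{{_ : NonZero d}} → v * d ≤ x → x < suc v * d → x / d ≡ v
/-unique {x} {v} d vd≤x x<[1+v]d = ≤-antisym (≤-pred (m<n*o⇒m/o<n x<[1+v]d))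
  (≤-trans (≤-reflexive (sym (m*n/n≡m v d))) (/-monoˡ-≤ d vd≤x))

-- q² − q − 2, which is the value of k − 1.
k-1 : ℕ → ℕ
k-1 r = (2 + r) + (2 + 4 * r + r * r)

-- Division with remainder: after scaling by `c`, the numerator is `c * v + r` times the denominator
-- `B`, and `r < c`, so the quotient is `v`. Here `k-1 r` has the form `c + d`, ready for `C-suc`.
upperBound≡ : ∀ r .(c≤ : 2 + r ≤ k-1 r) →
  upperBound (2 + k-1 r) (2 + r) (1 + k-1 r) c≤ ≡ (3 + r) * (3 + r) + (1 + r)
upperBound≡ r c≤ = /-unique B {{C-nonZero c≤}} lower upper
  where
  open ≤-Reasoning
  c = 2 + r
  d = 2 + 4 * r + r * r
  A = (2 + k-1 r) C c
  A′ = (1 + k-1 r) C c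
  B = k-1 r C c
  v = (3 + r) * (3 + r) + (1 + r)
  instance
    _ : NonZero B
    -- The hypothesis `c≤` is irrelevant, so a relevant proof of the same inequality is supplied.
    _ = C-nonZero (m≤m+n c d)
  A*≡ : A * (2 + d) * (1 + d) ≡ (2 + k-1 r) * ((1 + k-1 r) * B)
  A*≡ = begin-equality
    A * (2 + d) * (1 + d)                  ≡⟨ cong (λ n → (n C c) * (2 + d) * (1 + d)) (cong suc (+-suc c d)) ⟨
    (suc (c + suc d) C c) * (2 + d) * (1 + d) ≡⟨ cong (_* (1 + d)) (C-suc c (suc d)) ⟩
    suc (c + suc d) * ((c + suc d) C c) * (1 + d) ≡⟨ cong (λ n → suc n * (n C c) * (1 + d)) (+-suc c d) ⟩
    (2 + k-1 r) * A′ * (1 + d)             ≡⟨ *-assoc (2 + k-1 r) A′ (1 + d) ⟩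
    (2 + k-1 r) * (A′ * (1 + d))           ≡⟨ cong ((2 + k-1 r) *_) (C-suc c d) ⟩
    (2 + k-1 r) * ((1 + k-1 r) * B)        ∎
  scaled : c * (k-1 r * A) ≡ (c * v + r) * B
  -- With q = 3 + r, `2 + d` is (q - 1)² and `1 + d` is q(q - 2), so `c` times the chosen factor is
  -- `(2 + d) * (1 + d)`, the multiplier in `A*≡`.
  scaled = *-cancelʳ-≡ _ _ ((1 + r) * (2 + r) * (3 + r)) (begin-equality
    c * (k-1 r * A) * ((1 + r) * (2 + r) * (3 + r)) ≡⟨ left r A ⟩
    k-1 r * (A * (2 + d) * (1 + d))                 ≡⟨ cong (k-1 r *_) A*≡ ⟩
    k-1 r * ((2 + k-1 r) * ((1 + k-1 r) * B))       ≡⟨ right r B ⟩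
    (c * v + r) * B * ((1 + r) * (2 + r) * (3 + r)) ∎)
    where
    left : ∀ r A → (2 + r) * (((2 + r) + (2 + 4 * r + r * r)) * A) * ((1 + r) * (2 + r) * (3 + r)) ≡
      ((2 + r) + (2 + 4 * r + r * r)) * (A * (2 + (2 + 4 * r + r * r)) * (1 + (2 + 4 * r + r * r)))
    left = solve-∀
    right : ∀ r B → ((2 + r) + (2 + 4 * r + r * r)) *
      ((2 + ((2 + r) + (2 + 4 * r + r * r))) * ((1 + ((2 + r) + (2 + 4 * r + r * r))) * B)) ≡
      ((2 + r) * ((3 + r) * (3 + r) + (1 + r)) + r) * B * ((1 + r) * (2 + r) * (3 + r))
    right = solve-∀
  lower : v * B ≤ k-1 r * A
  lower = *-cancelˡ-≤ c (begin
    c * (v * B)       ≡⟨ *-assoc c v B ⟨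
    c * v * B         ≤⟨ *-monoˡ-≤ B (m≤m+n (c * v) r) ⟩
    (c * v + r) * B   ≡⟨ scaled ⟨
    c * (k-1 r * A)   ∎)
  upper : k-1 r * A < suc v * B
  upper = *-cancelˡ-< c _ _ (begin-strict
    c * (k-1 r * A)   ≡⟨ scaled ⟩
    (c * v + r) * B   <⟨ *-monoˡ-< B (+-monoʳ-< (c * v) (m<n+m r z<s)) ⟩
    (c * v + c) * B   ≡⟨ cong (_* B) (trans (+-comm (c * v) c) (sym (*-suc c v))) ⟩
    c * suc v * B     ≡⟨ *-assoc c (suc v) B ⟩
    c * (suc v * B)   ∎)

-- Parameters of the code as polynomials.

-- Replaces a truncated subtraction by an additive identity that the ring solver can prove.
m≡n+o⇒m∸n≡o : ∀ {m} n {o} → m ≡ n + o → m ∸ n ≡ o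
m≡n+o⇒m∸n≡o n {o} refl = m+n∸m≡n n o

q²∸q≡ : ∀ r → (3 + r) ^ 2 ∸ (3 + r) ≡ 2 + k-1 r
q²∸q≡ r = m≡n+o⇒m∸n≡o (3 + r) (expand r)
  where
  expand : ∀ r → (3 + r) * ((3 + r) * 1) ≡ (3 + r) + (2 + ((2 + r) + (2 + 4 * r + r * r)))
  expand = solve-∀

[q-1]q≡ : ∀ r → (2 + r) * (3 + r) ≡ 2 + k-1 r
[q-1]q≡ = expand
  where
  expand : ∀ r → (2 + r) * (3 + r) ≡ 2 + ((2 + r) + (2 + 4 * r + r * r))
  expand = solve-∀

-- Used at `2 + r`: here `suc q` is the group size of the design and `q` the block size.
q³∸q²≡ : ∀ q → suc q ^ 3 ∸ suc q ^ 2 ≡ suc q * suc q * q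
q³∸q²≡ q = m≡n+o⇒m∸n≡o (suc q ^ 2) (expand q)
  where
  expand : ∀ q → (1 + q) * ((1 + q) * ((1 + q) * 1)) ≡ (1 + q) * ((1 + q) * 1) + (1 + q) * (1 + q) * q
  expand = solve-∀

q^2≡ : ∀ q → q ^ 2 ≡ q * q
q^2≡ q = cong (q *_) (*-identityʳ q)

-- The type of `p` depends on `k`; keeping `m` and `k` variable lets both equations be matched with
-- `refl`, which carries `p` along.
upperBound-q : ∀ r {m k} → m ≡ 2 + k-1 r → k ≡ 1 + k-1 r → .(p : 2 + r ≤ k ∸ 1) →
  upperBound m (2 + r) k p ≡ (3 + r) * (3 + r) + (1 + r)
upperBound-q r refl refl p = upperBound≡ r p

-- The gap as an integer, and assembly of the result.

open import Data.Integer.Base using (+_; _-_; _⊖_)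
open import Data.Integer.Properties using ([+m]-[+n]≡m⊖n; +-cancelˡ-⊖)

[m+n]-m : ∀ m n → (+ (m + n)) - (+ m) ≡ + n
[m+n]-m m n = begin
  (+ (m + n)) - (+ m)   ≡⟨ [+m]-[+n]≡m⊖n (m + n) m ⟩
  (m + n) ⊖ m           ≡⟨ cong ((m + n) ⊖_) (+-identityʳ m) ⟨
  (m + n) ⊖ (m + 0)     ≡⟨ +-cancelˡ-⊖ m n 0 ⟩
  + n                   ∎
  where open ≡-Reasoning

theorem18 : (q : ℕ) → IsPrimePower q → (3≤q : 3 ≤ q) →
    (D : TransversalDesign (q ∸ 1) q) → Resolution D →
    IsCBC (q ^ 2) (q ^ 3 ∸ q ^ 2) (q ^ 2 ∸ q ∸ 1) (q ^ 2 ∸ q) (𝒞₁ D) ×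
    Uniform (q ∸ 1) (𝒞₁ D) ×
    (+ upperBound (q ^ 2 ∸ q) (q ∸ 1) (q ^ 2 ∸ q ∸ 1) (c≤k-1 3≤q)) - (+ (q ^ 2)) ≡ (+ q) - (+ 2)
theorem18 q@(suc (suc (suc r))) _ 3≤q@(s≤s (s≤s (s≤s _))) D res = isCBC , block-size , gap
  where
  open TransversalDesign D
  k≡ : q ^ 2 ∸ q ∸ 1 ≡ 1 + k-1 r
  k≡ = cong (_∸ 1) (q²∸q≡ r)
  isCBC : IsCBC (q ^ 2) (q ^ 3 ∸ q ^ 2) (q ^ 2 ∸ q ∸ 1) (q ^ 2 ∸ q) (𝒞₁ D)
  isCBC = record
    { items       = trans (numBlocks≡ D res) (sym (q^2≡ q))
    ; servers     = trans ([q-1]q≡ r) (sym (q²∸q≡ r))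
    ; storage≡N   = storage≡
    ; retrievable = λ b b-injective →
        let s , s-injective , s∈ = systemOfDistinctRepresentatives (block ∘ b)
              (∣blocks∣≤∣points∣ D b b-injective
                -- The number of retrieved items is one less than the number of servers, so the
                -- strict bound holds as an equality of successors.
                (≤-reflexive (trans (cong suc k≡) (sym ([q-1]q≡ r)))))
        in s , s-injective , s∈
    }
    where
    open ≡-Reasoning
    storage≡ : Code.storage (𝒞₁ D) ≡ q ^ 3 ∸ q ^ 2
    storage≡ = begin
      sum (λ B → ∣ block B ∣)           ≡⟨ sum-cong-≗ block-size ⟩
      sum {numBlocks} (λ _ → 2 + r)     ≡⟨ sum-const numBlocks (2 + r) ⟩
      numBlocks * (2 + r)               ≡⟨ cong (_* (2 + r)) (numBlocks≡ D res) ⟩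
      q * q * (2 + r)                   ≡⟨ q³∸q²≡ (2 + r) ⟨
      q ^ 3 ∸ q ^ 2                     ∎
  gap : (+ upperBound (q ^ 2 ∸ q) (q ∸ 1) (q ^ 2 ∸ q ∸ 1) (c≤k-1 3≤q)) - (+ (q ^ 2)) ≡ (+ q) - (+ 2)
  gap = begin
    (+ upperBound (q ^ 2 ∸ q) (2 + r) (q ^ 2 ∸ q ∸ 1) (c≤k-1 3≤q)) - (+ (q ^ 2))
      ≡⟨ cong₂ (λ u n → (+ u) - (+ n)) (upperBound-q r (q²∸q≡ r) k≡ (c≤k-1 3≤q)) (q^2≡ q) ⟩
    (+ (q * q + (1 + r))) - (+ (q * q))
      ≡⟨ [m+n]-m (q * q) (1 + r) ⟩
    -- With `q` equal to `3 + r`, `(+ q) - (+ 2)` computes to this value.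
    + (1 + r) ∎
    where open ≡-Reasoning
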